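{- For every positive integer $n$ with $n\equiv 50 \pmod{288}$, there exists a simple planar graph $G$ on $n$ vertices containing neither $K_4$ nor $C_6$ as a subgraph such that $e(G)=\frac{7}{3}(n-2)$.
   Context: $K_4$ is the complete graph on $4$ vertices, $C_6$ the cycle on $6$ vertices; $e(G)$ is the number of edges of $G$. -}

module Defs where

open import Data.Fin as Fin using (Fin; toℕ)
import Data.Fin.Properties as Fin
open import Data.List using (List; []; _∷_; _∷ʳ_; length; filter; cartesianProduct; allFin)
open import Data.Nat as ℕ using (ℕ; suc; _%_)
import Data.Nat.Properties as ℕ
open import Data.Nat.DivMod using (m<n⇒m%n≡m; n%n≡0)
open import Data.Product using (Σ; ∃-syntax; _×_; _,_)
open import Data.Rational as ℚ using (ℚ; 0ℚ; 1ℚ)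
open import Data.Sum using (_⊎_; inj₁; inj₂; swap)
open import Data.Unit using (⊤)
open import Function.Definitions using (Injective)
open import Level using (0ℓ)
open import Relation.Binary using (Rel; Symmetric; Irreflexive; Decidable)
open import Relation.Binary.PropositionalEquality using (_≡_; _≢_; refl; sym; trans)
open import Relation.Nullary using (yes; no)
open import Relation.Nullary.Decidable using (_×-dec_; _⊎-dec_; ¬?)

record SimpleGraph (n : ℕ) : Set₁ where
  field
    Adj        : Rel (Fin n) 0ℓ
    adj?       : Decidable Adj
    adj-sym    : Symmetric Adj
    adj-irrefl : Irreflexive _≡_ Adj

  -- Each undirected edge {u , v} is represented once, by its pair with u < v.
  IsEdge : Rel (Fin n) 0ℓ
  IsEdge u v = u Fin.< v × Adj u v

  isEdge? : Decidable IsEdge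
  isEdge? u v = (u Fin.<? v) ×-dec adj? u v

  edges : List (Fin n × Fin n)
  edges = filter (λ (u , v) → isEdge? u v) (cartesianProduct (allFin n) (allFin n))

  e : ℕ
  e = length edges

open SimpleGraph public using (e)

-- H is isomorphic to a (not necessarily induced) subgraph of G.
_⊑_ : ∀ {m n} → SimpleGraph m → SimpleGraph n → Set
_⊑_ {m} {n} H G =
  Σ (Fin m → Fin n) λ f → Injective _≡_ _≡_ f × (∀ {i j} → H.Adj i j → G.Adj (f i) (f j))
  where
  module H = SimpleGraph H
  module G = SimpleGraph G

K : (n : ℕ) → SimpleGraph n
K n = record
  { Adj        = _≢_
  ; adj?       = λ i j → ¬? (i Fin.≟ j)
  ; adj-sym    = λ i≢j j≡i → i≢j (sym j≡i)
  ; adj-irrefl = λ i≡j i≢j → i≢j i≡j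
  }

suc%≢ : ∀ k i → i ℕ.< suc (suc k) → suc i % suc (suc k) ≢ i
suc%≢ k i i<n eq with suc i ℕ.<? suc (suc k)
... | yes 1+i<n = ℕ.1+n≢n (trans (sym (m<n⇒m%n≡m 1+i<n)) eq)
... | no  1+i≮n with ℕ.≤-antisym i<n (ℕ.≮⇒≥ 1+i≮n)
...   | refl with trans (sym (n%n≡0 (suc (suc k)))) eq
...     | ()

-- The cycle on 3 + k vertices.
C₃₊ : (k : ℕ) → SimpleGraph (3 ℕ.+ k)
C₃₊ k = record
  { Adj        = λ i j → Next i j ⊎ Next j i
  ; adj?       = λ i j → next? i j ⊎-dec next? j i
  ; adj-sym    = swap
  ; adj-irrefl = λ { {i} refl (inj₁ p) → suc%≢ (suc k) (toℕ i) (Fin.toℕ<n i) p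
                   ; {i} refl (inj₂ p) → suc%≢ (suc k) (toℕ i) (Fin.toℕ<n i) p }
  }
  where
  Next : Rel (Fin (3 ℕ.+ k)) 0ℓ
  Next i j = suc (toℕ i) % (3 ℕ.+ k) ≡ toℕ j

  next? : Decidable Next
  next? i j = suc (toℕ i) % (3 ℕ.+ k) ℕ.≟ toℕ j

K₄ : SimpleGraph 4
K₄ = K 4

C₆ : SimpleGraph 6
C₆ = C₃₊ 3

-- Plane drawings have polygonal arcs as edges, with rational coordinates.
-- Segments with rational endpoints that meet in the real plane meet in a
-- rational point (and if they meet in more than one point, they share more than one
-- rational point), so the conditions below agree with those over ℝ.

Point : Set
Point = ℚ × ℚ

OnSegment : Point → Point → Point → Set
OnSegment p (ax , ay) (bx , by) =
  ∃[ t ] 0ℚ ℚ.≤ t × t ℚ.≤ 1ℚ ×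
    p ≡ ((1ℚ ℚ.- t) ℚ.* ax ℚ.+ t ℚ.* bx , (1ℚ ℚ.- t) ℚ.* ay ℚ.+ t ℚ.* by)

-- The polyline with successive corners a ∷ bs, as a set of points.
OnPolyline : Point → Point → List Point → Set
OnPolyline p a []       = p ≡ a
OnPolyline p a (b ∷ bs) = OnSegment p a b ⊎ OnPolyline p b bs

-- The polyline does not meet itself: each segment is nondegenerate and meets
-- the remainder of the polyline only in its own final point.
IsArc : Point → List Point → Set
IsArc a []       = ⊤
IsArc a (b ∷ bs) =
  a ≢ b × (∀ p → OnSegment p a b → OnPolyline p b bs → p ≡ b) × IsArc b bs

record PlaneDrawing {n : ℕ} (G : SimpleGraph n) : Set where
  open SimpleGraph G
  field
    pos     : Fin n → Point
    pos-inj : Injective _≡_ _≡_ pos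
    -- Interior corners of the arc drawn for the edge (u , v); irrelevant
    -- unless IsEdge u v.
    bends   : Fin n → Fin n → List Point

  corners : Fin n → Fin n → List Point
  corners u v = bends u v ∷ʳ pos v

  OnArc : Point → Fin n → Fin n → Set
  OnArc p u v = OnPolyline p (pos u) (corners u v)

  field
    arcs : ∀ {u v} → IsEdge u v → IsArc (pos u) (corners u v)
    vertex-on-arc : ∀ {u v} → IsEdge u v → ∀ w → OnArc (pos w) u v → w ≡ u ⊎ w ≡ v
    arcs-meet : ∀ {u v u′ v′} → IsEdge u v → IsEdge u′ v′ → (u , v) ≢ (u′ , v′) →
                ∀ p → OnArc p u v → OnArc p u′ v′ →
                ∃[ w ] (w ≡ u ⊎ w ≡ v) × (w ≡ u′ ⊎ w ≡ v′) × p ≡ pos w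

Planar : ∀ {n} → SimpleGraph n → Set
Planar = PlaneDrawing

{-# OPTIONS --safe #-}
module Submission where

-- The graph is assembled from wheels W₄ (a hub joined to a 4-cycle) glued at
-- rim vertices so that every face that is not a triangle of a wheel has length 7.
-- Then 4e = 7f, which by Euler's formula is e = 7(n − 2)/3.  Triangles occur
-- only inside wheels, so there is no K₄; any cycle that visits several wheels
-- has length at least 7, and a wheel has only 5 vertices, so there is no C₆.
--
-- An infinite family is a tower: a bottom cap of 7 wheels, then r rings of
-- 7 wheels each, then a top cap of 7 wheels, where consecutive pieces share
-- 4 vertices.  It has 50 + 24r vertices, and r = 12q gives n = 50 + 288q.
-- In the plane every piece surrounds the previous one and the ring pieces are
-- copies of one another under scaling by 3.  Hence planarity, and
-- the absence of K₄ and C₆, reduce to finitely many local computations.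

open import Data.Bool using (true; if_then_else_)
open import Data.Bool.Properties using (T-≡)
open import Data.Fin as Fin using (Fin; toℕ; fromℕ<; punchIn)
open import Data.Fin.Patterns
import Data.Fin.Properties as Fin
open import Data.Integer as ℤ using (ℤ; +_; _⊖_; 0ℤ)
import Data.Integer.Properties as ℤ
open import Data.List using (List; []; _∷_; _++_; map; concatMap; applyUpTo; upTo; length; cartesianProduct; allFin)
open import Data.List.Membership.Propositional using (_∈_; _∉_)
open import Data.List.Membership.Propositional.Properties
open import Data.List.Membership.Propositional.Properties.WithK using (unique∧set⇒bag)
open import Data.List.Properties using (length-++; length-map; map-cong-local)
open import Data.List.Relation.Binary.BagAndSetEquality using (∼bag⇒↭)
open import Data.List.Relation.Binary.Permutation.Propositional.Properties using (↭-length)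
open import Data.List.Relation.Unary.All as All using (All; []; _∷_)
import Data.List.Relation.Unary.All.Properties as All
open import Data.List.Relation.Unary.AllPairs as AllPairs using (AllPairs; []; _∷_)
import Data.List.Relation.Unary.AllPairs.Properties as AllPairs
open import Data.List.Relation.Unary.Any as Any using (Any; here; there)
open import Data.List.Relation.Unary.Unique.Propositional using (Unique)
import Data.List.Relation.Unary.Unique.Propositional.Properties as Unique
open import Data.Nat as ℕ using (ℕ; zero; suc; _+_; _∸_; _≤_; _<_; _%_; _<ᵇ_; _≡ᵇ_; z≤n; s≤s)
import Data.Nat.DivMod as ℕ
import Data.Nat.Properties as ℕ
open import Data.Nat.Tactic.RingSolver using (solve-∀)
open import Data.Product using (Σ; ∃-syntax; _×_; _,_; proj₁; proj₂)
import Data.Product.Properties as Product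
open import Data.Rational as ℚ using (ℚ; 0ℚ; 1ℚ; _/_; _*_; _-_; toℚᵘ)
import Data.Rational.Properties as ℚ
open import Data.Rational.Solver using (module +-*-Solver)
import Data.Rational.Unnormalised as ℚᵘ
import Data.Rational.Unnormalised.Properties as ℚᵘ
open import Data.Sum as Sum using (_⊎_; inj₁; inj₂)
open import Data.Unit using (⊤; tt)
open import Function using (_∘_; id; mk⇔)
open import Function.Bundles using (module Equivalence)
open import Function.Definitions using (Injective)
open import Relation.Binary.Definitions using (tri<; tri≈; tri>)
open import Relation.Binary.PropositionalEquality
open import Relation.Nullary using (¬_; Dec; contradiction)
open import Relation.Nullary.Decidable using (_×-dec_; _⊎-dec_; ¬?; toWitness; decidable-stable)
open import Data.List.Membership.DecPropositional ℕ._≟_ using (_∈?_; _∉?_)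
open import Data.List.Membership.DecPropositional (Product.≡-dec ℕ._≟_ ℕ._≟_) using () renaming (_∈?_ to _∈²?_)
open import Defs

-- Integers as rationals

ι : ℤ → ℚ
ι i = i / 1

-- Arithmetic in ℚ normalises by a gcd and is stuck on a variable numerator. In the unnormalised
-- fraction i/1 the denominator stays 1, so the laws for `ι` become integer identities.
toℚᵘ-ι : ∀ i → toℚᵘ (ι i) ℚᵘ.≃ ℚᵘ.mkℚᵘ i 0
toℚᵘ-ι i = ℚ.toℚᵘ-fromℚᵘ (ℚᵘ.mkℚᵘ i 0)

ι-+ : ∀ i j → ι (i ℤ.+ j) ≡ ι i ℚ.+ ι j
ι-+ i j = ℚ.toℚᵘ-injective (begin
  toℚᵘ (ι (i ℤ.+ j))                   ≈⟨ toℚᵘ-ι (i ℤ.+ j) ⟩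
  ℚᵘ.mkℚᵘ (i ℤ.+ j) 0                  ≈⟨ ℚᵘ.*≡* (cong (ℤ._* ℤ.1ℤ) (cong₂ ℤ._+_ (sym (ℤ.*-identityʳ i)) (sym (ℤ.*-identityʳ j)))) ⟩
  ℚᵘ.mkℚᵘ i 0 ℚᵘ.+ ℚᵘ.mkℚᵘ j 0         ≈⟨ ℚᵘ.+-cong (toℚᵘ-ι i) (toℚᵘ-ι j) ⟨
  toℚᵘ (ι i) ℚᵘ.+ toℚᵘ (ι j)           ≈⟨ ℚ.toℚᵘ-homo-+ (ι i) (ι j) ⟨
  toℚᵘ (ι i ℚ.+ ι j)                   ∎)
  where open ℚᵘ.≃-Reasoning

ι-* : ∀ i j → ι (i ℤ.* j) ≡ ι i ℚ.* ι j
ι-* i j = ℚ.toℚᵘ-injective (begin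
  toℚᵘ (ι (i ℤ.* j))                   ≈⟨ toℚᵘ-ι (i ℤ.* j) ⟩
  ℚᵘ.mkℚᵘ i 0 ℚᵘ.* ℚᵘ.mkℚᵘ j 0         ≈⟨ ℚᵘ.*-cong (toℚᵘ-ι i) (toℚᵘ-ι j) ⟨
  toℚᵘ (ι i) ℚᵘ.* toℚᵘ (ι j)           ≈⟨ ℚ.toℚᵘ-homo-* (ι i) (ι j) ⟨
  toℚᵘ (ι i ℚ.* ι j)                   ∎)
  where open ℚᵘ.≃-Reasoning

ι-mono-≤ : ∀ {i j} → i ℤ.≤ j → ι i ℚ.≤ ι j
ι-mono-≤ {i} {j} i≤j = ℚ.toℚᵘ-cancel-≤ (begin
  toℚᵘ (ι i)    ≃⟨ toℚᵘ-ι i ⟩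
  ℚᵘ.mkℚᵘ i 0   ≤⟨ ℚᵘ.*≤* (ℤ.*-monoʳ-≤-nonNeg ℤ.1ℤ i≤j) ⟩
  ℚᵘ.mkℚᵘ j 0   ≃⟨ toℚᵘ-ι j ⟨
  toℚᵘ (ι j)    ∎)
  where open ℚᵘ.≤-Reasoning

ι-mono-< : ∀ {i j} → i ℤ.< j → ι i ℚ.< ι j
ι-mono-< {i} {j} i<j = ℚ.toℚᵘ-cancel-< (begin-strict
  toℚᵘ (ι i)    ≃⟨ toℚᵘ-ι i ⟩
  ℚᵘ.mkℚᵘ i 0   <⟨ ℚᵘ.*<* (ℤ.*-monoʳ-<-pos ℤ.1ℤ i<j) ⟩
  ℚᵘ.mkℚᵘ j 0   ≃⟨ toℚᵘ-ι j ⟨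
  toℚᵘ (ι j)    ∎)
  where open ℚᵘ.≤-Reasoning

-- Convex combinations

mix : ℚ → ℚ → ℚ → ℚ
mix t x y = (1ℚ ℚ.- t) ℚ.* x ℚ.+ t ℚ.* y

mix-const : ∀ t x → mix t x x ≡ x
mix-const = solve 2 (λ t x → (con 1ℚ :- t) :* x :+ t :* x := x) refl
  where open +-*-Solver

mix-flip : ∀ t x y → mix t x y ≡ mix (1ℚ ℚ.- t) y x
mix-flip = solve 3 (λ t x y → (con 1ℚ :- t) :* x :+ t :* y
                           := (con 1ℚ :- (con 1ℚ :- t)) :* y :+ (con 1ℚ :- t) :* x) refl
  where open +-*-Solver

mix-0 : ∀ x y → mix 0ℚ x y ≡ x
mix-0 = solve 2 (λ x y → (con 1ℚ :- con 0ℚ) :* x :+ con 0ℚ :* y := x) refl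
  where open +-*-Solver

mix-linear : ∀ α β t x x′ y y′ →
  α ℚ.* mix t x x′ ℚ.+ β ℚ.* mix t y y′ ≡ mix t (α ℚ.* x ℚ.+ β ℚ.* y) (α ℚ.* x′ ℚ.+ β ℚ.* y′)
mix-linear = solve 7 (λ α β t x x′ y y′ →
     α :* ((con 1ℚ :- t) :* x :+ t :* x′) :+ β :* ((con 1ℚ :- t) :* y :+ t :* y′)
  := (con 1ℚ :- t) :* (α :* x :+ β :* y) :+ t :* (α :* x′ :+ β :* y′)) refl
  where open +-*-Solver

0≤1-t : ∀ {t} → t ℚ.≤ 1ℚ → 0ℚ ℚ.≤ 1ℚ ℚ.- t
0≤1-t {t} t≤1 = subst (ℚ._≤ 1ℚ ℚ.- t) (ℚ.+-inverseʳ t) (ℚ.+-monoˡ-≤ (ℚ.- t) t≤1)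

1-t≤1 : ∀ {t} → 0ℚ ℚ.≤ t → 1ℚ ℚ.- t ℚ.≤ 1ℚ
1-t≤1 {t} 0≤t = subst (1ℚ ℚ.- t ℚ.≤_) (ℚ.+-identityʳ 1ℚ) (ℚ.+-monoʳ-≤ 1ℚ (ℚ.neg-antimono-≤ 0≤t))

mix-mono-≤ : ∀ {t x x′ y y′} → 0ℚ ℚ.≤ t → t ℚ.≤ 1ℚ → x ℚ.≤ x′ → y ℚ.≤ y′ → mix t x y ℚ.≤ mix t x′ y′
mix-mono-≤ {t} 0≤t t≤1 x≤x′ y≤y′ =
  ℚ.+-mono-≤ (ℚ.*-monoˡ-≤-nonNeg (1ℚ ℚ.- t) {{ℚ.nonNegative (0≤1-t t≤1)}} x≤x′)
             (ℚ.*-monoˡ-≤-nonNeg t {{ℚ.nonNegative 0≤t}} y≤y′)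

mix-≥ : ∀ {t γ x y} → 0ℚ ℚ.≤ t → t ℚ.≤ 1ℚ → γ ℚ.≤ x → γ ℚ.≤ y → γ ℚ.≤ mix t x y
mix-≥ {t} {γ} {x} {y} 0≤t t≤1 γ≤x γ≤y =
  subst (ℚ._≤ mix t x y) (mix-const t γ) (mix-mono-≤ 0≤t t≤1 γ≤x γ≤y)

mix-< : ∀ {t γ x y} → 0ℚ ℚ.≤ t → t ℚ.≤ 1ℚ → x ℚ.< γ → y ℚ.< γ → mix t x y ℚ.< γ
mix-< {t} {γ} {x} {y} 0≤t t≤1 x<γ y<γ with ℚ.≤-total x y
... | inj₁ x≤y = ℚ.≤-<-trans (subst (mix t x y ℚ.≤_) (mix-const t y) (mix-mono-≤ 0≤t t≤1 x≤y ℚ.≤-refl)) y<γ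
... | inj₂ y≤x = ℚ.≤-<-trans (subst (mix t x y ℚ.≤_) (mix-const t x) (mix-mono-≤ 0≤t t≤1 ℚ.≤-refl y≤x)) x<γ

-- Any positive weight on y < γ pulls the mixture strictly below γ.
mix-≥⇒t≡0 : ∀ {t γ y} → 0ℚ ℚ.≤ t → y ℚ.< γ → γ ℚ.≤ mix t γ y → t ≡ 0ℚ
mix-≥⇒t≡0 {t} {γ} {y} 0≤t y<γ γ≤m with ℚ.<-cmp 0ℚ t
... | tri≈ _ 0≡t _ = sym 0≡t
... | tri> _ _ t<0 = contradiction (ℚ.≤-<-trans 0≤t t<0) (ℚ.<-irrefl refl)
... | tri< 0<t _ _ = contradiction (ℚ.≤-<-trans γ≤m m<γ) (ℚ.<-irrefl refl)
  where
  m<γ : mix t γ y ℚ.< γ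
  m<γ = subst (mix t γ y ℚ.<_) (mix-const t γ)
    (ℚ.+-monoʳ-< ((1ℚ ℚ.- t) ℚ.* γ) (ℚ.*-monoʳ-<-pos t {{ℚ.positive 0<t}} y<γ))

-- Segments with integral endpoints

OnSegment-flip : ∀ {p a b} → OnSegment p a b → OnSegment p b a
OnSegment-flip {p} {ax , ay} {bx , by} (t , 0≤t , t≤1 , p≡) =
  1ℚ ℚ.- t , 0≤1-t t≤1 , 1-t≤1 0≤t , trans p≡ (cong₂ _,_ (mix-flip t ax bx) (mix-flip t ay by))

OnSegment-start : ∀ {a b} → OnSegment a a b
OnSegment-start {ax , ay} {bx , by} =
  0ℚ , ℚ.≤-refl , toWitness {a? = 0ℚ ℚ.≤? 1ℚ} tt , sym (cong₂ _,_ (mix-0 ax bx) (mix-0 ay by))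

OnSegment-end : ∀ {a b} → OnSegment b a b
OnSegment-end = OnSegment-flip OnSegment-start

Pt : Set
Pt = ℤ × ℤ

_·_ : Pt → Pt → ℤ
(α , β) · (x , y) = α ℤ.* x ℤ.+ β ℤ.* y

ι² : Pt → Point
ι² (x , y) = (ι x , ι y)

value : Pt → Point → ℚ
value (α , β) (x , y) = ι α ℚ.* x ℚ.+ ι β ℚ.* y

value-ι² : ∀ ℓ p → value ℓ (ι² p) ≡ ι (ℓ · p)
value-ι² (α , β) (x , y) = sym (trans (ι-+ (α ℤ.* x) (β ℤ.* y)) (cong₂ ℚ._+_ (ι-* α x) (ι-* β y)))

-- Linear functionals commute with convex combinations, so the position of a point of a segment
-- relative to a line is governed by two integers.
value-mix : ∀ ℓ {P} a b t →
  P ≡ ((1ℚ ℚ.- t) ℚ.* ι (proj₁ a) ℚ.+ t ℚ.* ι (proj₁ b) , (1ℚ ℚ.- t) ℚ.* ι (proj₂ a) ℚ.+ t ℚ.* ι (proj₂ b)) →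
  value ℓ P ≡ mix t (ι (ℓ · a)) (ι (ℓ · b))
value-mix ℓ@(α , β) a@(ax , ay) b@(bx , by) t refl =
  trans (mix-linear (ι α) (ι β) t (ι ax) (ι bx) (ι ay) (ι by)) (cong₂ (mix t) (value-ι² ℓ a) (value-ι² ℓ b))

above-segment : ∀ ℓ {γ P} a b → OnSegment P (ι² a) (ι² b) →
                γ ℤ.≤ ℓ · a → γ ℤ.≤ ℓ · b → ι γ ℚ.≤ value ℓ P
above-segment ℓ {γ} a b (t , 0≤t , t≤1 , P≡) γ≤a γ≤b =
  subst (ι γ ℚ.≤_) (sym (value-mix ℓ a b t P≡)) (mix-≥ 0≤t t≤1 (ι-mono-≤ γ≤a) (ι-mono-≤ γ≤b))

below-segment : ∀ ℓ {γ P} a b → OnSegment P (ι² a) (ι² b) →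
                ℓ · a ℤ.< γ → ℓ · b ℤ.< γ → value ℓ P ℚ.< ι γ
below-segment ℓ {γ} a b (t , 0≤t , t≤1 , P≡) a<γ b<γ =
  subst (ℚ._< ι γ) (sym (value-mix ℓ a b t P≡)) (mix-< 0≤t t≤1 (ι-mono-< a<γ) (ι-mono-< b<γ))

-- This handles two segments with a common vertex: the separating line passes through that vertex
-- and the rest of one segment is strictly below it.
endpoint-of-segment : ∀ ℓ {γ P} a b → OnSegment P (ι² a) (ι² b) →
                      ℓ · a ≡ γ → ℓ · b ℤ.< γ → ι γ ℚ.≤ value ℓ P → P ≡ ι² a
endpoint-of-segment ℓ {P = P} a b (t , 0≤t , t≤1 , P≡) refl b<γ γ≤P
  with refl ← mix-≥⇒t≡0 0≤t (ι-mono-< b<γ) (subst (ι (ℓ · a) ℚ.≤_) (value-mix ℓ a b t P≡) γ≤P)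
  = trans P≡ (cong₂ _,_ (mix-0 (ι (proj₁ a)) (ι (proj₁ b))) (mix-0 (ι (proj₂ a)) (ι (proj₂ b))))

degenerate-segment : ∀ {P} a → OnSegment P a a → P ≡ a
degenerate-segment (x , y) (t , _ , _ , P≡) = trans P≡ (cong₂ _,_ (mix-const t x) (mix-const t y))

-- The pieces of the tower

data Piece : Set where
  bottom ring top : Piece

-- Local indices run over 0 … 27.  The upper shared vertices 24 … 27 of a piece
-- are the lower shared vertices 0 … 3 of the next one, so that index x of the
-- g-th piece denotes vertex 24g + x.  The bottom cap starts at 1.

data Wheel : Set where
  wheel : (hub a b c d : ℕ) → Wheel

wheels : Piece → List Wheel
wheels bottom =
    wheel 5 1 2 3 4 ∷ wheel 8 2 27 6 7 ∷ wheel 12 6 9 10 11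
  ∷ wheel 15 10 24 13 14 ∷ wheel 18 14 25 16 17 ∷ wheel 20 17 19 26 1
  ∷ wheel 23 4 21 11 22 ∷ []
wheels ring =
    wheel 7 4 5 3 6 ∷ wheel 10 5 8 24 9 ∷ wheel 13 9 11 12 0
  ∷ wheel 16 11 25 14 15 ∷ wheel 19 15 17 18 1 ∷ wheel 21 17 26 20 2
  ∷ wheel 23 20 22 27 4 ∷ []
wheels top =
    wheel 24 4 5 6 7 ∷ wheel 25 5 3 9 10 ∷ wheel 26 10 12 2 13
  ∷ wheel 17 13 15 1 16 ∷ wheel 21 16 18 19 20 ∷ wheel 23 19 0 4 22
  ∷ wheel 14 6 8 20 11 ∷ []

Pair : Set
Pair = ℕ × ℕ

sorted : ℕ → ℕ → Pair
sorted a b = if a <ᵇ b then (a , b) else (b , a)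

wheelEdges : Wheel → List Pair
wheelEdges (wheel h a b c d) =
    sorted h a ∷ sorted h b ∷ sorted h c ∷ sorted h d
  ∷ sorted a b ∷ sorted b c ∷ sorted c d ∷ sorted d a ∷ []

pieceEdges : Piece → List Pair
pieceEdges k = concatMap wheelEdges (wheels k)

shift : Pair → Pair
shift (u , v) = (24 + u , 24 + v)

edgesOf : List Piece → List Pair
edgesOf []       = []
edgesOf (k ∷ ks) = pieceEdges k ++ map shift (edgesOf ks)

storeys : ℕ → List Piece
storeys zero    = top ∷ []
storeys (suc r) = ring ∷ storeys r

tower : ℕ → List Piece
tower r = bottom ∷ storeys r

Joined : List Piece → ℕ → ℕ → Set
Joined ks u v = (u , v) ∈ edgesOf ks ⊎ (v , u) ∈ edgesOf ks

joined-sym : ∀ {ks u v} → Joined ks u v → Joined ks v u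
joined-sym = Sum.swap

-- The bound 24 says that no piece joins two of its upper shared vertices. The smaller endpoint of
-- an edge therefore decides whether the edge lies in the first piece or above it.
pieceEdges-ordered : ∀ k → All (λ (u , v) → u < 24 × u < v) (pieceEdges k)
pieceEdges-ordered = λ { bottom → toWitness {a? = check? bottom} tt
                       ; ring   → toWitness {a? = check? ring} tt
                       ; top    → toWitness {a? = check? top} tt }
  where
  check? : ∀ k → Dec (All (λ (u , v) → u < 24 × u < v) (pieceEdges k))
  check? k = All.all? (λ (u , v) → (u ℕ.<? 24) ×-dec (u ℕ.<? v)) (pieceEdges k)

edge-view : ∀ k ks {u v} → (u , v) ∈ edgesOf (k ∷ ks) →
            (u , v) ∈ pieceEdges k ⊎ ∃[ u′ ] ∃[ v′ ] (u′ , v′) ∈ edgesOf ks × u ≡ 24 + u′ × v ≡ 24 + v′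
edge-view k ks uv∈ with ∈-++⁻ (pieceEdges k) uv∈
... | inj₁ here∈ = inj₁ here∈
... | inj₂ above∈ with (u′ , v′) , u′v′∈ , refl ← ∈-map⁻ shift above∈ = inj₂ (u′ , v′ , u′v′∈ , refl , refl)

edge-ordered : ∀ ks {u v} → (u , v) ∈ edgesOf ks → u < v
edge-ordered (k ∷ ks) uv∈ with edge-view k ks uv∈
... | inj₁ here∈ = proj₂ (All.lookup (pieceEdges-ordered k) here∈)
... | inj₂ (u′ , v′ , u′v′∈ , refl , refl) = ℕ.+-monoʳ-< 24 (edge-ordered ks u′v′∈)

edge-above : ∀ k ks {u v} → 24 ≤ u → (u , v) ∈ edgesOf (k ∷ ks) → (u ∸ 24 , v ∸ 24) ∈ edgesOf ks
edge-above k ks 24≤u uv∈ with edge-view k ks uv∈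
... | inj₁ here∈ = contradiction 24≤u (ℕ.<⇒≱ (proj₁ (All.lookup (pieceEdges-ordered k) here∈)))
... | inj₂ (u′ , v′ , u′v′∈ , refl , refl) = u′v′∈

joined-above : ∀ {k ks u v} → 24 ≤ u → 24 ≤ v → Joined (k ∷ ks) u v → Joined ks (u ∸ 24) (v ∸ 24)
joined-above {k} {ks} 24≤u 24≤v = Sum.map (edge-above k ks 24≤u) (edge-above k ks 24≤v)

-- Neighbours

around : ℕ → Wheel → List ℕ
around u (wheel h a b c d) =
  if u ≡ᵇ h then a ∷ b ∷ c ∷ d ∷ [] else
  if u ≡ᵇ a then h ∷ b ∷ d ∷ [] else
  if u ≡ᵇ b then h ∷ a ∷ c ∷ [] else
  if u ≡ᵇ c then h ∷ b ∷ d ∷ [] else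
  if u ≡ᵇ d then h ∷ a ∷ c ∷ [] else []

pieceNbrs : Piece → ℕ → List ℕ
pieceNbrs k u = concatMap (around u) (wheels k)

pieceNbrs-complete : ∀ k → All (λ (u , v) → v ∈ pieceNbrs k u × u ∈ pieceNbrs k v) (pieceEdges k)
pieceNbrs-complete = λ { bottom → toWitness {a? = check? bottom} tt
                       ; ring   → toWitness {a? = check? ring} tt
                       ; top    → toWitness {a? = check? top} tt }
  where
  check? : ∀ k → Dec (All (λ (u , v) → v ∈ pieceNbrs k u × u ∈ pieceNbrs k v) (pieceEdges k))
  check? k = All.all? (λ (u , v) → (v ∈? pieceNbrs k u) ×-dec (u ∈? pieceNbrs k v)) (pieceEdges k)

-- The guard stops the recursion at numerals below 24, so these lists evaluate even when the upper
-- pieces are a variable. Completeness suffices below: a spurious entry could only make the checks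
-- stricter.
nbrs : List Piece → ℕ → List ℕ
nbrs []       u = []
nbrs (k ∷ ks) u =
  pieceNbrs k u ++ (if u <ᵇ 24 then [] else map (24 ℕ.+_) (nbrs ks (u ∸ 24)))

edge-nbrs : ∀ ks {u v} → (u , v) ∈ edgesOf ks → v ∈ nbrs ks u × u ∈ nbrs ks v
edge-nbrs (k ∷ ks) uv∈ with edge-view k ks uv∈
... | inj₁ here∈ = let v∈ , u∈ = All.lookup (pieceNbrs-complete k) here∈ in ∈-++⁺ˡ v∈ , ∈-++⁺ˡ u∈
... | inj₂ (u′ , v′ , u′v′∈ , refl , refl) = let v∈ , u∈ = edge-nbrs ks u′v′∈ in
  ∈-++⁺ʳ (pieceNbrs k (24 + u′)) (∈-map⁺ (24 ℕ.+_) v∈) , ∈-++⁺ʳ (pieceNbrs k (24 + v′)) (∈-map⁺ (24 ℕ.+_) u∈)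

joined-nbrs : ∀ {ks u v} → Joined ks u v → v ∈ nbrs ks u
joined-nbrs {ks} (inj₁ uv∈) = proj₁ (edge-nbrs ks uv∈)
joined-nbrs {ks} (inj₂ vu∈) = proj₂ (edge-nbrs ks vu∈)

-- A cycle all of whose vertices are at least 24 lies in the pieces above the
-- first one, so a condition on cycles through a vertex below 24 of every
-- suffix of the tower suffices.

Everywhere : (List Piece → Set) → List Piece → Set
Everywhere P []       = ⊤
Everywhere P (k ∷ ks) = P (k ∷ ks) × Everywhere P ks

-- Hexagons

allPairs-lookup : ∀ {A : Set} {R : A → A → Set} {xs x y} → AllPairs R xs → x ∈ xs → y ∈ xs → x ≡ y ⊎ R x y ⊎ R y x
allPairs-lookup (_ ∷ _)   (here refl) (here refl) = inj₁ refl
allPairs-lookup (px ∷ _)  (here refl) (there y∈)  = inj₂ (inj₁ (All.lookup px y∈))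
allPairs-lookup (px ∷ _)  (there x∈)  (here refl) = inj₂ (inj₂ (All.lookup px x∈))
allPairs-lookup (_ ∷ pxs) (there x∈)  (there y∈)  = allPairs-lookup pxs x∈ y∈

-- `onward` holds the neighbours of `end`, the candidates for the vertex of a hexagon opposite the
-- start. With it, `NoJoin` compares two walks without reference to the tower.
record Walk : Set where
  constructor walk
  field
    mid end : ℕ
    onward  : List ℕ

walks : List Piece → ℕ → List Walk
walks ks v = concatMap (λ a → map (λ b → walk a b (nbrs ks b)) (nbrs ks a)) (nbrs ks v)

∈-walks : ∀ {ks v a b} → a ∈ nbrs ks v → b ∈ nbrs ks a → walk a b (nbrs ks b) ∈ walks ks v
∈-walks {ks} a∈ b∈ =
  ∈-concatMap⁺ (λ a → map (λ b → walk a b (nbrs ks b)) (nbrs ks a))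
    (Any.map (λ { refl → ∈-map⁺ (λ b → walk _ b (nbrs ks b)) b∈ }) a∈)

-- The walks v – a – b and v – e – d are not two halves of a hexagon v a b c d e.
NoJoin : ℕ → Walk → Walk → Set
NoJoin v (walk a b bs) (walk e d ds) =
  a ≡ e ⊎ b ≡ d ⊎ b ≡ v ⊎ d ≡ v ⊎ a ≡ d ⊎ b ≡ e ⊎
  All (λ c → c ≡ v ⊎ c ≡ a ⊎ c ≡ e ⊎ c ∉ ds) bs

noJoin? : ∀ v s t → Dec (NoJoin v s t)
noJoin? v (walk a b bs) (walk e d ds) =
  a ℕ.≟ e ⊎-dec b ℕ.≟ d ⊎-dec b ℕ.≟ v ⊎-dec d ℕ.≟ v ⊎-dec a ℕ.≟ d ⊎-dec b ℕ.≟ e ⊎-dec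
  All.all? (λ c → c ℕ.≟ v ⊎-dec c ℕ.≟ a ⊎-dec c ℕ.≟ e ⊎-dec c ∉? ds) bs

NoHexagon : List Piece → Set
NoHexagon ks = All (λ v → AllPairs (NoJoin v) (walks ks v)) (upTo 24)

noHexagon? : ∀ ks → Dec (NoHexagon ks)
noHexagon? ks = All.all? (λ v → AllPairs.allPairs? (noJoin? v) (walks ks v)) (upTo 24)

next prev : Fin 6 → Fin 6
next 0F = 1F
next 1F = 2F
next 2F = 3F
next 3F = 4F
next 4F = 5F
next 5F = 0F
prev 0F = 5F
prev 1F = 0F
prev 2F = 1F
prev 3F = 2F
prev 4F = 3F
prev 5F = 4F

prev-next : ∀ i → prev (next i) ≡ i
prev-next 0F = refl
prev-next 1F = refl
prev-next 2F = refl
prev-next 3F = refl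
prev-next 4F = refl
prev-next 5F = refl

IsHexagon : List Piece → (Fin 6 → ℕ) → Set
IsHexagon ks f = Injective _≡_ _≡_ f × (∀ i → Joined ks (f i) (f (next i)))

rotate : ∀ {ks f} → IsHexagon ks f → IsHexagon ks (f ∘ next)
rotate (inj , adj) = (λ {i} {j} eq → trans (sym (prev-next i)) (trans (cong prev (inj eq)) (prev-next j))) , adj ∘ next

-- The walks 0, 1, 2 and 0, 5, 4 along the hexagon both continue to vertex 3, which `NoJoin`
-- forbids.
hexagon-low₀ : ∀ {ks f} → NoHexagon ks → IsHexagon ks f → ¬ f 0F < 24
hexagon-low₀ {ks} {f} none (inj , adj) v<24 =
  excluded (allPairs-lookup (All.lookup none (∈-upTo⁺ v<24)) ab∈ ed∈)
  where
  apart : ∀ {i j} → i ≢ j → f i ≢ f j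
  apart i≢j eq = i≢j (inj eq)

  forward : ∀ i → f (next i) ∈ nbrs ks (f i)
  forward i = joined-nbrs {ks} (adj i)

  backward : ∀ i → f i ∈ nbrs ks (f (next i))
  backward i = joined-nbrs {ks} (joined-sym {ks} (adj i))

  ab∈ : walk (f 1F) (f 2F) (nbrs ks (f 2F)) ∈ walks ks (f 0F)
  ab∈ = ∈-walks {ks} (forward 0F) (forward 1F)

  ed∈ : walk (f 5F) (f 4F) (nbrs ks (f 4F)) ∈ walks ks (f 0F)
  ed∈ = ∈-walks {ks} (backward 5F) (backward 4F)

  -- `AllPairs` relates the two walks in the order of the list, which is unknown here. The indices
  -- stay variable so that both orders are covered.
  joined : ∀ a b e d → a ≢ e → b ≢ d → b ≢ 0F → d ≢ 0F → a ≢ d → b ≢ e → 3F ≢ a → 3F ≢ e →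
           f 3F ∈ nbrs ks (f b) → f 3F ∈ nbrs ks (f d) →
           ¬ NoJoin (f 0F) (walk (f a) (f b) (nbrs ks (f b))) (walk (f e) (f d) (nbrs ks (f d)))
  joined a b e d a≢e b≢d b≢v d≢v a≢d b≢e c≢a c≢e c∈b c∈d = λ
    { (inj₁ p)                                           → apart a≢e p
    ; (inj₂ (inj₁ p))                                    → apart b≢d p
    ; (inj₂ (inj₂ (inj₁ p)))                             → apart b≢v p
    ; (inj₂ (inj₂ (inj₂ (inj₁ p))))                      → apart d≢v p
    ; (inj₂ (inj₂ (inj₂ (inj₂ (inj₁ p)))))               → apart a≢d p
    ; (inj₂ (inj₂ (inj₂ (inj₂ (inj₂ (inj₁ p))))))        → apart b≢e p
    ; (inj₂ (inj₂ (inj₂ (inj₂ (inj₂ (inj₂ cs)))))) → close (All.lookup cs c∈b)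
    }
    where
    close : ¬ (f 3F ≡ f 0F ⊎ f 3F ≡ f a ⊎ f 3F ≡ f e ⊎ f 3F ∉ nbrs ks (f d))
    close (inj₁ p)                  = apart (λ ()) p
    close (inj₂ (inj₁ p))           = apart c≢a p
    close (inj₂ (inj₂ (inj₁ p)))    = apart c≢e p
    close (inj₂ (inj₂ (inj₂ c∉d)))  = c∉d c∈d

  W₁ W₂ : Walk
  W₁ = walk (f 1F) (f 2F) (nbrs ks (f 2F))
  W₂ = walk (f 5F) (f 4F) (nbrs ks (f 4F))

  excluded : ¬ (W₁ ≡ W₂ ⊎ NoJoin (f 0F) W₁ W₂ ⊎ NoJoin (f 0F) W₂ W₁)
  excluded (inj₁ W₁≡W₂)   = apart {1F} {5F} (λ ()) (cong Walk.mid W₁≡W₂)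
  excluded (inj₂ (inj₁ p)) =
    joined 1F 2F 5F 4F (λ ()) (λ ()) (λ ()) (λ ()) (λ ()) (λ ()) (λ ()) (λ ()) (forward 2F) (backward 3F) p
  excluded (inj₂ (inj₂ p)) =
    joined 5F 4F 1F 2F (λ ()) (λ ()) (λ ()) (λ ()) (λ ()) (λ ()) (λ ()) (λ ()) (backward 3F) (forward 2F) p

-- A rotation brings any vertex of the hexagon to position 0.
hexagon-low : ∀ {ks f} → NoHexagon ks → IsHexagon ks f → ∀ i → ¬ f i < 24
hexagon-low {ks} none h = λ
  { 0F → hexagon-low₀ {ks} none h
  ; 1F → hexagon-low₀ {ks} none (r h)
  ; 2F → hexagon-low₀ {ks} none (r (r h))
  ; 3F → hexagon-low₀ {ks} none (r (r (r h)))
  ; 4F → hexagon-low₀ {ks} none (r (r (r (r h))))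
  ; 5F → hexagon-low₀ {ks} none (r (r (r (r (r h)))))
  }
  where
  r : ∀ {f} → IsHexagon ks f → IsHexagon ks (f ∘ next)
  r = rotate {ks}

hexagon-free : ∀ ks → Everywhere NoHexagon ks → ∀ {f} → ¬ IsHexagon ks f
hexagon-free []       _             (_ , adj) with adj 0F
... | inj₁ ()
... | inj₂ ()
hexagon-free (k ∷ ks) (none , rest) {f} h@(inj , adj) =
  hexagon-free ks rest
    ( (λ {i} {j} eq → inj (ℕ.∸-cancelʳ-≡ (high i) (high j) eq))
    , (λ i → joined-above {k} {ks} (high i) (high (next i)) (adj i)) )
  where
  high : ∀ i → 24 ≤ f i
  high i = ℕ.≮⇒≥ (hexagon-low {k ∷ ks} none h i)

-- The check looks only two steps away from a vertex below 24, hence only at the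
-- first four pieces, so it evaluates although the number of rings is a variable.
storeys-noHexagon₀ : ∀ r → NoHexagon (storeys r)
storeys-noHexagon₀ 0 = toWitness {a? = noHexagon? (storeys 0)} tt
storeys-noHexagon₀ 1 = toWitness {a? = noHexagon? (storeys 1)} tt
storeys-noHexagon₀ 2 = toWitness {a? = noHexagon? (storeys 2)} tt
storeys-noHexagon₀ 3 = toWitness {a? = noHexagon? (storeys 3)} tt
storeys-noHexagon₀ (suc (suc (suc (suc r)))) =
  toWitness {a? = noHexagon? (ring ∷ ring ∷ ring ∷ ring ∷ storeys r)} tt

storeys-noHexagon : ∀ r → Everywhere NoHexagon (storeys r)
storeys-noHexagon zero    = storeys-noHexagon₀ zero , tt
storeys-noHexagon (suc r) = storeys-noHexagon₀ (suc r) , storeys-noHexagon r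

tower-noHexagon : ∀ r → Everywhere NoHexagon (tower r)
tower-noHexagon r = check r , storeys-noHexagon r
  where
  check : ∀ r → NoHexagon (tower r)
  check 0 = toWitness {a? = noHexagon? (tower 0)} tt
  check 1 = toWitness {a? = noHexagon? (tower 1)} tt
  check 2 = toWitness {a? = noHexagon? (tower 2)} tt
  check (suc (suc (suc r))) = toWitness {a? = noHexagon? (bottom ∷ ring ∷ ring ∷ ring ∷ storeys r)} tt

-- Cliques

-- With `vs` the neighbourhood of a vertex, this says that `vs` contains no triangle a b c, that is,
-- no K₄ passes through that vertex.
NoCliqueAt : List Piece → List ℕ → Set
NoCliqueAt ks vs =
  All (λ a → All (λ b → b ∉ vs ⊎ All (λ c → c ∉ vs ⊎ c ∉ nbrs ks a) (nbrs ks b)) (nbrs ks a)) vs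

NoClique : List Piece → Set
NoClique ks = All (λ v → NoCliqueAt ks (nbrs ks v)) (upTo 24)

noClique? : ∀ ks → Dec (NoClique ks)
noClique? ks = All.all? (λ v → at? (nbrs ks v)) (upTo 24)
  where
  at? : ∀ vs → Dec (NoCliqueAt ks vs)
  at? vs = All.all? (λ a → All.all? (λ b →
    b ∉? vs ⊎-dec All.all? (λ c → c ∉? vs ⊎-dec c ∉? nbrs ks a) (nbrs ks b)) (nbrs ks a)) vs

IsClique : List Piece → (Fin 4 → ℕ) → Set
IsClique ks f = ∀ {i j} → i ≢ j → Joined ks (f i) (f j)

-- `punchIn i` enumerates the other three vertices of the clique; they form a triangle among the
-- neighbours of vertex `i`.
clique-low : ∀ {ks f} → NoClique ks → IsClique ks f → ∀ i → ¬ f i < 24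
clique-low {ks} {f} none adj i v<24 =
  excluded (All.lookup (All.lookup (All.lookup none (∈-upTo⁺ v<24)) (from-i 0F)) (among 0F 1F λ ()))
  where
  from-i : ∀ j → f (punchIn i j) ∈ nbrs ks (f i)
  from-i j = joined-nbrs {ks} (adj (λ eq → Fin.punchInᵢ≢i i j (sym eq)))

  among : ∀ j l → j ≢ l → f (punchIn i l) ∈ nbrs ks (f (punchIn i j))
  among j l j≢l = joined-nbrs {ks} (adj (λ eq → j≢l (Fin.punchIn-injective i j l eq)))

  vs : List ℕ
  vs = nbrs ks (f i)

  excluded : ¬ (f (punchIn i 1F) ∉ vs
              ⊎ All (λ c → c ∉ vs ⊎ c ∉ nbrs ks (f (punchIn i 0F))) (nbrs ks (f (punchIn i 1F))))
  excluded (inj₁ b∉v) = b∉v (from-i 1F)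
  excluded (inj₂ cs)  =
    Sum.[ (λ c∉v → c∉v (from-i 2F)) , (λ c∉a → c∉a (among 0F 2F λ ())) ]′ (All.lookup cs (among 1F 2F λ ()))

clique-free : ∀ ks → Everywhere NoClique ks → ∀ {f} → ¬ IsClique ks f
clique-free []       _             adj with adj {0F} {1F} (λ ())
... | inj₁ ()
... | inj₂ ()
clique-free (k ∷ ks) (none , rest) {f} adj =
  clique-free ks rest (λ {i} {j} i≢j → joined-above {k} {ks} (high i) (high j) (adj i≢j))
  where
  high : ∀ i → 24 ≤ f i
  high i = ℕ.≮⇒≥ (clique-low {k ∷ ks} none adj i)

-- Neighbours are computed only for vertices at most two steps from one below 24. These are at most
-- 51, so three explicit pieces determine the outcome for every `r`.
storeys-noClique₀ : ∀ r → NoClique (storeys r)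
storeys-noClique₀ 0 = toWitness {a? = noClique? (storeys 0)} tt
storeys-noClique₀ 1 = toWitness {a? = noClique? (storeys 1)} tt
storeys-noClique₀ 2 = toWitness {a? = noClique? (storeys 2)} tt
storeys-noClique₀ (suc (suc (suc r))) = toWitness {a? = noClique? (ring ∷ ring ∷ ring ∷ storeys r)} tt

storeys-noClique : ∀ r → Everywhere NoClique (storeys r)
storeys-noClique zero    = storeys-noClique₀ zero , tt
storeys-noClique (suc r) = storeys-noClique₀ (suc r) , storeys-noClique r

tower-noClique : ∀ r → Everywhere NoClique (tower r)
tower-noClique r = check r , storeys-noClique r
  where
  check : ∀ r → NoClique (tower r)
  check 0 = toWitness {a? = noClique? (tower 0)} tt
  check 1 = toWitness {a? = noClique? (tower 1)} tt
  check (suc (suc r)) = toWitness {a? = noClique? (bottom ∷ ring ∷ ring ∷ storeys r)} tt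

-- Separating functionals

-- Points carry the vertex they represent, because two segments may meet in a
-- common vertex.

Node : Set
Node = ℕ × Pt

Segment : Set
Segment = Node × Node

place : (ℕ → Pt) → Pair → Segment
place f (u , v) = ((u , f u) , (v , f v))

Below : Pt → ℤ → ℕ → Node → Set
Below ℓ γ w (c , p) = ℓ · p ℤ.< γ ⊎ (ℓ · p ≡ γ × c ≡ w)

below? : ∀ ℓ γ w n → Dec (Below ℓ γ w n)
below? ℓ γ w (c , p) = (ℓ · p ℤ.<? γ) ⊎-dec ((ℓ · p ℤ.≟ γ) ×-dec (c ℕ.≟ w))

Separated : Segment → Segment → Set
Separated (m , n) ((a , p) , (b , q)) =
  ∃[ ℓ ] ∃[ γ ] ∃[ w ] (w ≡ a ⊎ w ≡ b) × Below ℓ γ w m × Below ℓ γ w n × γ ℤ.≤ ℓ · p × γ ℤ.≤ ℓ · q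

-- On the second segment the functional is at least γ. The first segment attains this only at an
-- endpoint representing `w`, which is also an endpoint of the second.
separated-meet : ∀ f {c d a b P} → Separated (place f (c , d)) (place f (a , b)) →
  OnSegment P (ι² (f c)) (ι² (f d)) → OnSegment P (ι² (f a)) (ι² (f b)) →
  ∃[ w ] (w ≡ c ⊎ w ≡ d) × (w ≡ a ⊎ w ≡ b) × P ≡ ι² (f w)
separated-meet f {c} {d} {a} {b} {P} (ℓ , γ , w , w∈ab , c↓ , d↓ , γ≤a , γ≤b) P∈cd P∈ab = go c↓ d↓
  where
  γ≤P : ι γ ℚ.≤ value ℓ P
  γ≤P = above-segment ℓ (f a) (f b) P∈ab γ≤a γ≤b

  go : Below ℓ γ w (c , f c) → Below ℓ γ w (d , f d) → _
  go (inj₁ c<γ) (inj₁ d<γ) =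
    contradiction (ℚ.≤-<-trans γ≤P (below-segment ℓ (f c) (f d) P∈cd c<γ d<γ)) (ℚ.<-irrefl refl)
  go (inj₁ c<γ) (inj₂ (d≡γ , refl)) =
    w , inj₂ refl , w∈ab , endpoint-of-segment ℓ (f d) (f c) (OnSegment-flip P∈cd) d≡γ c<γ γ≤P
  go (inj₂ (c≡γ , refl)) (inj₁ d<γ) =
    w , inj₁ refl , w∈ab , endpoint-of-segment ℓ (f c) (f d) P∈cd c≡γ d<γ γ≤P
  -- Both ends of the first segment are `w`, so it is a single point.
  go (inj₂ (_ , refl)) (inj₂ (_ , refl)) =
    w , inj₁ refl , w∈ab , degenerate-segment (ι² (f w)) P∈cd

SeparatedAt : (ℕ → Pt) → Pair → Pair → Set
SeparatedAt f e e′ = Separated (place f e) (place f e′)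

segments-meet : ∀ f {es a b c d P} → AllPairs (SeparatedAt f) es → (a , b) ∈ es → (c , d) ∈ es → (a , b) ≢ (c , d) →
  OnSegment P (ι² (f a)) (ι² (f b)) → OnSegment P (ι² (f c)) (ι² (f d)) →
  ∃[ w ] (w ≡ a ⊎ w ≡ b) × (w ≡ c ⊎ w ≡ d) × P ≡ ι² (f w)
segments-meet f {a = a} {b} {c} {d} {P} es∥ ab∈ cd∈ ab≢cd P∈ab P∈cd =
  Sum.[ (λ ab≡cd → contradiction ab≡cd ab≢cd)
      , Sum.[ (λ ab∥cd → separated-meet f ab∥cd P∈ab P∈cd)
            , (λ cd∥ab → flip (separated-meet f cd∥ab P∈cd P∈ab)) ]′ ]′ (allPairs-lookup es∥ ab∈ cd∈)
  where
  flip : ∃[ w ] (w ≡ c ⊎ w ≡ d) × (w ≡ a ⊎ w ≡ b) × P ≡ ι² (f w) →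
         ∃[ w ] (w ≡ a ⊎ w ≡ b) × (w ≡ c ⊎ w ≡ d) × P ≡ ι² (f w)
  flip (w , w∈cd , w∈ab , P≡w) = w , w∈ab , w∈cd , P≡w

_⊝_ : Pt → Pt → Pt
(x , y) ⊝ (x′ , y′) = (x ℤ.- x′ , y ℤ.- y′)

opposite normal : Pt → Pt
opposite (x , y) = (ℤ.- x , ℤ.- y)
normal   (x , y) = (ℤ.- y , x)

-- If two segments have a separating line, then one of them has a parallel
-- separating line; the last candidate separates degenerate segments.
candidates : Segment → Segment → List Pt
candidates ((_ , p) , (_ , q)) ((_ , p′) , (_ , q′)) =
    normal (q ⊝ p) ∷ opposite (normal (q ⊝ p))
  ∷ normal (q′ ⊝ p′) ∷ opposite (normal (q′ ⊝ p′))
  ∷ (p′ ⊝ p) ∷ []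

BothBelow : Node → Node → Pt → ℕ → ℤ → Set
BothBelow m n ℓ w γ = Below ℓ γ w m × Below ℓ γ w n

-- For a fixed direction the minimum over the second segment is the best threshold, so only the
-- direction and the contact vertex are searched.
Separates : Segment → Segment → Pt → Set
Separates (m , n) ((a , p) , (b , q)) ℓ =
  BothBelow m n ℓ a (ℓ · p ℤ.⊓ ℓ · q) ⊎ BothBelow m n ℓ b (ℓ · p ℤ.⊓ ℓ · q)

separates? : ∀ e e′ ℓ → Dec (Separates e e′ ℓ)
separates? (m , n) ((a , p) , (b , q)) ℓ = decide (ℓ · p ℤ.⊓ ℓ · q)
  where
  decide : ∀ γ → Dec (BothBelow m n ℓ a γ ⊎ BothBelow m n ℓ b γ)
  decide γ = (below? ℓ γ a m ×-dec below? ℓ γ a n) ⊎-dec (below? ℓ γ b m ×-dec below? ℓ γ b n)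

separates⇒separated : ∀ e e′ ℓ → Separates e e′ ℓ → Separated e e′
separates⇒separated e ((a , p) , (b , q)) ℓ (inj₁ (m↓ , n↓)) =
  ℓ , _ , a , inj₁ refl , m↓ , n↓ , ℤ.i⊓j≤i (ℓ · p) (ℓ · q) , ℤ.i⊓j≤j (ℓ · p) (ℓ · q)
separates⇒separated e ((a , p) , (b , q)) ℓ (inj₂ (m↓ , n↓)) =
  ℓ , _ , b , inj₂ refl , m↓ , n↓ , ℤ.i⊓j≤i (ℓ · p) (ℓ · q) , ℤ.i⊓j≤j (ℓ · p) (ℓ · q)

-- Coordinates of the pieces

-- Shifted by 100, so that the tables contain natural numbers only.
pt : ℕ → ℕ → Pt
pt x y = (x ⊖ 100 , y ⊖ 100)

-- The lower shared vertices are at distance 14 from the origin on the axes and the upper ones at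
-- distance 42. Enlarging the next piece by 3 makes them coincide.
sites : Piece → List Pt
sites bottom =
    -- Index 0 does not occur in the bottom cap. The origin fills its place and lies below every
    -- line of positive level.
    pt 100 100 ∷ pt 86 106 ∷ pt 95 120 ∷ pt 95 114 ∷ pt 96 110
  ∷ pt 93 112 ∷ pt 104 120 ∷ pt 99 121 ∷ pt 100 126 ∷ pt 109 112
  ∷ pt 114 104 ∷ pt 103 111 ∷ pt 108 112 ∷ pt 123 93 ∷ pt 108 88
  ∷ pt 122 96 ∷ pt 94 77 ∷ pt 90 91 ∷ pt 98 78 ∷ pt 77 94
  ∷ pt 78 98 ∷ pt 100 111 ∷ pt 100 109 ∷ pt 100 110 ∷ pt 142 100
  ∷ pt 100 58 ∷ pt 58 100 ∷ pt 100 142 ∷ []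
sites ring =
    pt 114 100 ∷ pt 100 86 ∷ pt 86 100 ∷ pt 100 114 ∷ pt 99 118
  ∷ pt 112 109 ∷ pt 100 115 ∷ pt 103 114 ∷ pt 124 106 ∷ pt 118 97
  ∷ pt 124 103 ∷ pt 107 84 ∷ pt 110 92 ∷ pt 112 93 ∷ pt 98 73
  ∷ pt 97 83 ∷ pt 100 75 ∷ pt 85 93 ∷ pt 93 89 ∷ pt 94 88
  ∷ pt 85 112 ∷ pt 79 101 ∷ pt 92 125 ∷ pt 94 125 ∷ pt 142 100
  ∷ pt 100 58 ∷ pt 58 100 ∷ pt 100 142 ∷ []
sites top =
    pt 114 100 ∷ pt 100 86 ∷ pt 86 100 ∷ pt 100 114 ∷ pt 133 111
  ∷ pt 152 166 ∷ pt 184 100 ∷ pt 153 106 ∷ pt 152 34 ∷ pt 95 148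
  ∷ pt 81 182 ∷ pt 133 60 ∷ pt 80 140 ∷ pt 24 136 ∷ pt 138 53
  ∷ pt 60 107 ∷ pt 24 64 ∷ pt 52 98 ∷ pt 64 65 ∷ pt 94 71
  ∷ pt 81 18 ∷ pt 66 55 ∷ pt 116 90 ∷ pt 114 93 ∷ pt 156 121
  ∷ pt 107 152 ∷ pt 68 140 ∷ []

nth : List Pt → ℕ → Pt
nth []       _       = (0ℤ , 0ℤ)
nth (p ∷ ps) zero    = p
nth (p ∷ ps) (suc n) = nth ps n

site : Piece → ℕ → Pt
site k = nth (sites k)

-- Degenerate segments (x , x) let separation of segments also express that
-- vertices are distinct and lie on no other edge; vertices 0 … 3 belong to the piece below.
own : Piece → List ℕ
own bottom = applyUpTo (1 ℕ.+_) 27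
own ring   = applyUpTo (4 ℕ.+_) 24
own top    = applyUpTo (4 ℕ.+_) 23

pieceSegs : Piece → List Pair
pieceSegs k = map (λ x → (x , x)) (own k) ++ pieceEdges k

sites-separated : ∀ k → AllPairs (SeparatedAt (site k)) (pieceSegs k)
sites-separated k = AllPairs.map⁻ (AllPairs.map sound (check k))
  where
  sound : ∀ {e e′} → Any (Separates e e′) (candidates e e′) → Separated e e′
  sound {e} {e′} some with ℓ , s ← Any.satisfied some = separates⇒separated e e′ ℓ s

  Checked : Piece → Set
  Checked k = AllPairs (λ e e′ → Any (Separates e e′) (candidates e e′)) (map (place (site k)) (pieceSegs k))

  check? : ∀ k → Dec (Checked k)
  check? k = AllPairs.allPairs? (λ e e′ → Any.any? (separates? e e′) (candidates e e′)) _

  check : ∀ k → Checked k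
  check bottom = toWitness {a? = check? bottom} tt
  check ring   = toWitness {a? = check? ring} tt
  check top    = toWitness {a? = check? top} tt

Small : Pair → Set
Small (u , v) = u < 28 × v < 28

small : ∀ k → All Small (pieceSegs k)
small = λ { bottom → toWitness {a? = check? bottom} tt
          ; ring   → toWitness {a? = check? ring} tt
          ; top    → toWitness {a? = check? top} tt }
  where
  check? : ∀ k → Dec (All Small (pieceSegs k))
  check? k = All.all? (λ (u , v) → (u ℕ.<? 28) ×-dec (v ℕ.<? 28)) (pieceSegs k)

-- Stacking pieces

triple : Pt → Pt
triple (x , y) = (+ 3 ℤ.* x , + 3 ℤ.* y)

·-triple : ∀ ℓ p → ℓ · triple p ≡ + 3 ℤ.* (ℓ · p)
·-triple (α , β) (x , y) = begin
  α ℤ.* (+ 3 ℤ.* x) ℤ.+ β ℤ.* (+ 3 ℤ.* y)  ≡⟨ cong₂ ℤ._+_ (x∙yz≈y∙xz α (+ 3) x) (x∙yz≈y∙xz β (+ 3) y) ⟩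
  + 3 ℤ.* (α ℤ.* x) ℤ.+ + 3 ℤ.* (β ℤ.* y)  ≡⟨ ℤ.*-distribˡ-+ (+ 3) (α ℤ.* x) (β ℤ.* y) ⟨
  + 3 ℤ.* (α ℤ.* x ℤ.+ β ℤ.* y)              ∎
  where
  open ≡-Reasoning
  open import Algebra.Properties.CommutativeSemigroup ℤ.*-commutativeSemigroup using (x∙yz≈y∙xz)

triple-≤ : ∀ ℓ p {γ} → γ ℤ.≤ ℓ · p → + 3 ℤ.* γ ℤ.≤ ℓ · triple p
triple-≤ ℓ p {γ} γ≤p = subst (+ 3 ℤ.* γ ℤ.≤_) (sym (·-triple ℓ p)) (ℤ.*-monoˡ-≤-nonNeg (+ 3) γ≤p)

-- Enlarging what lies above, rather than shrinking what lies below, keeps all coordinates integral.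
stack : Piece → (ℕ → Pt) → ℕ → Pt
stack k f c = if c <ᵇ 24 then site k c else triple (f (c ∸ 24))

<⇒<ᵇ≡true : ∀ {m n} → m < n → (m <ᵇ n) ≡ true
<⇒<ᵇ≡true m<n = Equivalence.to T-≡ (ℕ.<⇒<ᵇ m<n)

data Floor : Piece → Set where
  bottom : Floor bottom
  ring   : Floor ring

Based : (ℕ → Pt) → Set
Based f = ∀ j → j < 4 → f j ≡ site ring j

interface : ∀ {k} → Floor k → ∀ j → j < 4 → triple (site ring j) ≡ site k (24 + j)
interface bottom 0 _ = refl
interface bottom 1 _ = refl
interface bottom 2 _ = refl
interface bottom 3 _ = refl
interface ring   0 _ = refl
interface ring   1 _ = refl
interface ring   2 _ = refl
interface ring   3 _ = refl
interface _ (suc (suc (suc (suc j)))) (s≤s (s≤s (s≤s (s≤s ()))))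

stack-site : ∀ {k f} → Floor k → Based f → ∀ {x} → x < 28 → stack k f x ≡ site k x
stack-site {k} {f} k↓ f↓ {x} x<28 = Sum.[ low , high ]′ (ℕ.<-≤-connex x 24)
  where
  low : x < 24 → stack k f x ≡ site k x
  low x<24 = cong (λ b → if b then site k x else triple (f (x ∸ 24))) (<⇒<ᵇ≡true x<24)

  shared : ∀ j → 24 + j < 28 → stack k f (24 + j) ≡ site k (24 + j)
  shared j 24+j<28 = trans (cong triple (f↓ j j<4)) (interface k↓ j j<4)
    where
    j<4 : j < 4
    j<4 = ℕ.+-cancelˡ-< 24 j 4 24+j<28

  high : 24 ≤ x → stack k f x ≡ site k x
  high 24≤x = subst (λ x → stack k f x ≡ site k x) (ℕ.m+[n∸m]≡n 24≤x)
    (shared (x ∸ 24) (subst (_< 28) (sym (ℕ.m+[n∸m]≡n 24≤x)) x<28))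

place-cong : ∀ {f g : ℕ → Pt} → (∀ {x} → x < 28 → f x ≡ g x) → ∀ {e} → Small e → place f e ≡ place g e
place-cong f≗g {u , v} (u< , v<) = cong₂ _,_ (cong (u ,_) (f≗g u<)) (cong (v ,_) (f≗g v<))

-- Scaling by 3 about the origin takes a separating line to a parallel one at three times the level.
separated-shift : ∀ k f e e′ → SeparatedAt f e e′ → SeparatedAt (stack k f) (shift e) (shift e′)
separated-shift k f (c , d) (a , b) (ℓ , γ , w , w∈ , c↓ , d↓ , γ≤a , γ≤b) =
  ℓ , + 3 ℤ.* γ , 24 + w , shift∈ w∈ , lift c↓ , lift d↓ , triple-≤ ℓ (f a) γ≤a , triple-≤ ℓ (f b) γ≤b
  where
  shift∈ : ∀ {a b} → w ≡ a ⊎ w ≡ b → 24 + w ≡ 24 + a ⊎ 24 + w ≡ 24 + b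
  shift∈ = Sum.map (cong (24 ℕ.+_)) (cong (24 ℕ.+_))

  lift : ∀ {x} → Below ℓ γ w (x , f x) → Below ℓ (+ 3 ℤ.* γ) (24 + w) (24 + x , triple (f x))
  lift {x} (inj₁ <γ) = inj₁ (subst (ℤ._< + 3 ℤ.* γ) (sym (·-triple ℓ (f x))) (ℤ.*-monoˡ-<-pos (+ 3) <γ))
  lift {x} (inj₂ (≡γ , refl)) = inj₂ (trans (·-triple ℓ (f x)) (cong (+ 3 ℤ.*_) ≡γ) , refl)

-- Beyond some line that has all lower pieces, drawn at the smaller scale, on
-- its other side; the line may pass through the shared vertex 24 + a only.
FloorBelow : Pt → ℤ → ℕ → Set
FloorBelow ℓ γ w = ∀ {k} → Floor k → All (λ x → Below ℓ γ w (x , site k x)) (upTo 28)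

Outside : Segment → Set
Outside ((a , p) , (b , q)) =
  ∃[ ℓ ] ∃[ γ ] 0ℤ ℤ.< γ × FloorBelow ℓ (+ 3 ℤ.* γ) (24 + a) × γ ℤ.≤ ℓ · p × γ ℤ.≤ ℓ · q

OutsideAt : (ℕ → Pt) → Pair → Set
OutsideAt f e = Outside (place f e)

-- At level 3γ the line has the floor piece on one side and the enlarged upper segment on the other;
-- the only possible contact is the shared vertex `24 + a`.
outside⇒separated : ∀ {k f} → Floor k → Based f → ∀ e e′ → Small e → OutsideAt f e′ →
                    SeparatedAt (stack k f) e (shift e′)
outside⇒separated {k} {f} k↓ f↓ (c , d) (a , b) (c< , d<) (ℓ , γ , 0<γ , under , γ≤a , γ≤b) =
  ℓ , + 3 ℤ.* γ , 24 + a , inj₁ refl , below c< , below d< , triple-≤ ℓ (f a) γ≤a , triple-≤ ℓ (f b) γ≤b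
  where
  below : ∀ {x} → x < 28 → Below ℓ (+ 3 ℤ.* γ) (24 + a) (x , stack k f x)
  below {x} x<28 = subst (λ p → Below ℓ (+ 3 ℤ.* γ) (24 + a) (x , p)) (sym (stack-site k↓ f↓ x<28))
    (All.lookup (under k↓) (∈-upTo⁺ x<28))

-- The floors stay at level at most 3γ while the segment moves out to level 3γ and its enlargement
-- to 9γ. Since γ is positive, 3γ < 9γ and all contact disappears.
outside-shift : ∀ k f e → OutsideAt f e → OutsideAt (stack k f) (shift e)
outside-shift k f (a , b) (ℓ , γ , 0<γ , under , γ≤a , γ≤b) =
  ℓ , + 3 ℤ.* γ , ℤ.*-monoˡ-<-pos (+ 3) 0<γ , (λ k↓ → All.map strict (under k↓)) , triple-≤ ℓ (f a) γ≤a , triple-≤ ℓ (f b) γ≤b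
  where
  3γ<9γ : + 3 ℤ.* γ ℤ.< + 3 ℤ.* (+ 3 ℤ.* γ)
  3γ<9γ = ℤ.*-monoˡ-<-pos (+ 3) (subst (ℤ._< + 3 ℤ.* γ) (ℤ.*-identityˡ γ)
            (ℤ.*-monoʳ-<-pos γ {{ℤ.positive 0<γ}} {ℤ.1ℤ} {+ 3} (ℤ.+<+ (s≤s (s≤s z≤n)))))

  strict : ∀ {w n} → Below ℓ (+ 3 ℤ.* γ) (24 + a) n → Below ℓ (+ 3 ℤ.* (+ 3 ℤ.* γ)) w n
  strict (inj₁ <3γ)       = inj₁ (ℤ.<-trans <3γ 3γ<9γ)
  strict (inj₂ (≡3γ , _)) = inj₁ (subst (ℤ._< _) (sym ≡3γ) 3γ<9γ)

-- Outward normals in all four quadrants, stored with offset 10. For every segment of a ring or a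
-- top cap one of them gives a suitable line, as `sites-outside` checks.
directions : List Pt
directions =
    dir 14 7 ∷ dir 7 14 ∷ dir 7 6 ∷ dir 11 12 ∷ dir 9 10 ∷ dir 9 6 ∷ dir 11 11 ∷ []
  where
  dir : ℕ → ℕ → Pt
  dir x y = (x ⊖ 10 , y ⊖ 10)

Encloses : ℕ → Pt → ℤ → Set
Encloses a ℓ γ = 0ℤ ℤ.< γ
  × All (λ x → Below ℓ (+ 3 ℤ.* γ) (24 + a) (x , site bottom x)) (upTo 28)
  × All (λ x → Below ℓ (+ 3 ℤ.* γ) (24 + a) (x , site ring x)) (upTo 28)

encloses? : ∀ a ℓ γ → Dec (Encloses a ℓ γ)
encloses? a ℓ γ = (0ℤ ℤ.<? γ)
  ×-dec All.all? (λ x → below? ℓ (+ 3 ℤ.* γ) (24 + a) (x , site bottom x)) (upTo 28)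
  ×-dec All.all? (λ x → below? ℓ (+ 3 ℤ.* γ) (24 + a) (x , site ring x)) (upTo 28)

OutsideBy : Segment → Pt → Set
OutsideBy ((a , p) , (b , q)) ℓ = Encloses a ℓ (ℓ · p ℤ.⊓ ℓ · q)

outsideBy? : ∀ e ℓ → Dec (OutsideBy e ℓ)
outsideBy? ((a , p) , (b , q)) ℓ = encloses? a ℓ (ℓ · p ℤ.⊓ ℓ · q)

outsideBy⇒outside : ∀ {e} → Any (OutsideBy e) directions → Outside e
outsideBy⇒outside {(a , p) , (b , q)} some with ℓ , (0<γ , under-bottom , under-ring) ← Any.satisfied some =
  ℓ , _ , 0<γ , (λ { bottom → under-bottom ; ring → under-ring }) ,
  ℤ.i⊓j≤i (ℓ · p) (ℓ · q) , ℤ.i⊓j≤j (ℓ · p) (ℓ · q)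

data Upper : Piece → Set where
  ring : Upper ring
  top  : Upper top

sites-outside : ∀ {k} → Upper k → All (OutsideAt (site k)) (pieceSegs k)
sites-outside {k} k↑ = All.map⁻ (All.map (λ {e} → outsideBy⇒outside {e}) (check k↑))
  where
  Checked : Piece → Set
  Checked k = All (λ e → Any (OutsideBy e) directions) (map (place (site k)) (pieceSegs k))

  check? : ∀ k → Dec (Checked k)
  check? k = All.all? (λ e → Any.any? (outsideBy? e) directions) _

  check : ∀ {k} → Upper k → Checked k
  check ring = toWitness {a? = check? ring} tt
  check top  = toWitness {a? = check? top} tt

-- Drawing of the whole tower

segsOf : List Piece → List Pair
segsOf []       = []
segsOf (k ∷ ks) = pieceSegs k ++ map shift (segsOf ks)

storeyPos : ℕ → ℕ → Pt
storeyPos zero    = site top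
storeyPos (suc r) = stack ring (storeyPos r)

towerPos : ℕ → ℕ → Pt
towerPos r = stack bottom (storeyPos r)

storey-based : ∀ r → Based (storeyPos r)
storey-based zero    0 _ = refl
storey-based zero    1 _ = refl
storey-based zero    2 _ = refl
storey-based zero    3 _ = refl
storey-based (suc r) 0 _ = refl
storey-based (suc r) 1 _ = refl
storey-based (suc r) 2 _ = refl
storey-based (suc r) 3 _ = refl
storey-based _ (suc (suc (suc (suc j)))) (s≤s (s≤s (s≤s (s≤s ()))))

stack-place : ∀ {k f} → Floor k → Based f → map (place (site k)) (pieceSegs k) ≡ map (place (stack k f)) (pieceSegs k)
stack-place {k} k↓ f↓ =
  map-cong-local (All.map (λ {e} e< → place-cong (λ x< → sym (stack-site k↓ f↓ x<)) {e} e<) (small k))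

stack-outside : ∀ {k f es} → Floor k → Upper k → Based f → All (OutsideAt f) es →
                All (OutsideAt (stack k f)) (pieceSegs k ++ map shift es)
stack-outside {k} {f} k↓ k↑ f↓ es↑ = All.++⁺
  (All.map⁻ (subst (All Outside) (stack-place k↓ f↓) (All.map⁺ (sites-outside k↑))))
  (All.map⁺ (All.map (λ {e} → outside-shift k f e) es↑))

storeys-outside : ∀ r → All (OutsideAt (storeyPos r)) (segsOf (storeys r))
storeys-outside zero    = alone top
  where
  alone : ∀ {k} → Upper k → All (OutsideAt (site k)) (segsOf (k ∷ []))
  alone k↑ = All.++⁺ (sites-outside k↑) []
storeys-outside (suc r) = stack-outside ring ring (storey-based r) (storeys-outside r)

-- There are three kinds of pairs: within the new piece by the finite check, within the upper part
-- by scaling, and across the two because upper segments lie outside the floor.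
stack-separated : ∀ {k f es} → Floor k → Based f → All (OutsideAt f) es → AllPairs (SeparatedAt f) es →
                  AllPairs (SeparatedAt (stack k f)) (pieceSegs k ++ map shift es)
stack-separated {k} {f} {es} k↓ f↓ es↑ es∥ = AllPairs.++⁺
  (AllPairs.map⁻ (subst (AllPairs Separated) (stack-place k↓ f↓) (AllPairs.map⁺ (sites-separated k))))
  (AllPairs.map⁺ (AllPairs.map (λ {e} {e′} → separated-shift k f e e′) es∥))
  (All.map (λ {e} e< → All.map⁺ (All.map (λ {e′} → outside⇒separated k↓ f↓ e e′ e<) es↑)) (small k))

storeys-separated : ∀ r → AllPairs (SeparatedAt (storeyPos r)) (segsOf (storeys r))
storeys-separated zero    = alone top
  where
  alone : ∀ k → AllPairs (SeparatedAt (site k)) (segsOf (k ∷ []))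
  alone k = AllPairs.++⁺ (sites-separated k) [] (All.universal (λ _ → []) (pieceSegs k))
storeys-separated (suc r) = stack-separated ring (storey-based r) (storeys-outside r) (storeys-separated r)

tower-separated : ∀ r → AllPairs (SeparatedAt (towerPos r)) (segsOf (tower r))
tower-separated r = stack-separated bottom (storey-based r) (storeys-outside r) (storeys-separated r)

-- Straight-line drawings

-- The bottom cap starts at vertex 1, whereas `Fin` starts at 0.
code : ∀ {n} → Fin n → ℕ
code i = suc (toℕ i)

code-injective : ∀ {n} {i j : Fin n} → code i ≡ code j → i ≡ j
code-injective = Fin.toℕ-injective ∘ ℕ.suc-injective

codes : ∀ {n} → Fin n × Fin n → Pair
codes (i , j) = (code i , code j)

codes-injective : ∀ {n} {e e′ : Fin n × Fin n} → codes e ≡ codes e′ → e ≡ e′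
codes-injective eq = cong₂ _,_ (code-injective (cong proj₁ eq)) (code-injective (cong proj₂ eq))

-- Since `es` contains the vertices as degenerate segments besides the edges, distinctness of
-- vertices, vertices on arcs and crossings of arcs are all instances of `segments-meet`.
module StraightLine {n} (G : SimpleGraph n) (f : ℕ → Pt) {es : List Pair} (es∥ : AllPairs (SeparatedAt f) es)
  (point∈ : ∀ (i : Fin n) → (code i , code i) ∈ es)
  (edge∈es : ∀ {i j} → SimpleGraph.IsEdge G i j → (code i , code j) ∈ es) where

  open SimpleGraph G using (IsEdge)

  pos : Fin n → Point
  pos i = ι² (f (code i))

  onSegment : ∀ {P u v} → OnPolyline P (pos u) (pos v ∷ []) → OnSegment P (pos u) (pos v)
  onSegment {P} {u} {v} = Sum.[ id , (λ P≡v → subst (λ P → OnSegment P (pos u) (pos v)) (sym P≡v) OnSegment-end) ]′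

  same : ∀ {w c : ℕ} → w ≡ c ⊎ w ≡ c → w ≡ c
  same = Sum.[ id , id ]′

  pos-inj : ∀ {i j} → pos i ≡ pos j → i ≡ j
  pos-inj {i} {j} eq = decidable-stable (i Fin.≟ j) λ i≢j →
    let w , w∈i , w∈j , _ = segments-meet f es∥ (point∈ i) (point∈ j) (i≢j ∘ code-injective ∘ cong proj₁)
                              OnSegment-start (subst (λ P → OnSegment P (pos j) (pos j)) (sym eq) OnSegment-start)
    in i≢j (code-injective (trans (sym (same w∈i)) (same w∈j)))

  vertex-on-arc : ∀ {u v} → IsEdge u v → ∀ w → OnPolyline (pos w) (pos u) (pos v ∷ []) → w ≡ u ⊎ w ≡ v
  vertex-on-arc {u} {v} uv@(u<v , _) w w∈ =
    let x , x∈w , x∈uv , _ = segments-meet f es∥ (point∈ w) (edge∈es uv) w≢uv OnSegment-start (onSegment {u = u} {v} w∈)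
    in Sum.map (code-injective ∘ trans (sym (same x∈w))) (code-injective ∘ trans (sym (same x∈w))) x∈uv
    where
    w≢uv : (code w , code w) ≢ (code u , code v)
    w≢uv eq = Fin.<⇒≢ u<v (code-injective (trans (sym (cong proj₁ eq)) (cong proj₂ eq)))

  arcs-meet : ∀ {u v u′ v′} → IsEdge u v → IsEdge u′ v′ → (u , v) ≢ (u′ , v′) → ∀ p →
    OnPolyline p (pos u) (pos v ∷ []) → OnPolyline p (pos u′) (pos v′ ∷ []) →
    ∃[ w ] (w ≡ u ⊎ w ≡ v) × (w ≡ u′ ⊎ w ≡ v′) × p ≡ pos w
  arcs-meet {u} {v} {u′} {v′} uv uv′ uv≢uv′ p p∈ p∈′ =
    decode (segments-meet f es∥ (edge∈es uv) (edge∈es uv′) (uv≢uv′ ∘ codes-injective)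
             (onSegment {u = u} {v} p∈) (onSegment {u = u′} {v′} p∈′))
    where
    decode : ∃[ c ] (c ≡ code u ⊎ c ≡ code v) × (c ≡ code u′ ⊎ c ≡ code v′) × p ≡ ι² (f c) →
             ∃[ w ] (w ≡ u ⊎ w ≡ v) × (w ≡ u′ ⊎ w ≡ v′) × p ≡ pos w
    decode (_ , inj₁ refl , c∈′ , p≡) = u , inj₁ refl , Sum.map code-injective code-injective c∈′ , p≡
    decode (_ , inj₂ refl , c∈′ , p≡) = v , inj₂ refl , Sum.map code-injective code-injective c∈′ , p≡

  planar : Planar G
  planar = record
    { pos           = pos
    ; pos-inj       = pos-inj
    ; bends         = λ _ _ → []
    ; arcs          = λ (u<v , _) → (λ eq → Fin.<⇒≢ u<v (pos-inj eq)) , (λ p _ p≡b → p≡b) , tt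
    ; vertex-on-arc = vertex-on-arc
    ; arcs-meet     = arcs-meet
    }

-- The graphs

-- The bottom cap has 27 vertices, the top cap adds 23 and each ring adds 24.
size : ℕ → ℕ
size r = 50 + r ℕ.* 24

graph : ∀ r → SimpleGraph (size r)
graph r = record
  { Adj        = λ i j → Joined (tower r) (code i) (code j)
  ; adj?       = λ i j → ((code i , code j) ∈²? edgesOf (tower r)) ⊎-dec ((code j , code i) ∈²? edgesOf (tower r))
  ; adj-sym    = joined-sym {tower r}
  ; adj-irrefl = λ { refl (inj₁ ii∈) → ℕ.<-irrefl refl (edge-ordered (tower r) ii∈)
                   ; refl (inj₂ ii∈) → ℕ.<-irrefl refl (edge-ordered (tower r) ii∈) }
  }

edge∈ : ∀ r {i j} → SimpleGraph.IsEdge (graph r) i j → (code i , code j) ∈ edgesOf (tower r)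
edge∈ r (i<j , inj₁ ij∈) = ij∈
edge∈ r (i<j , inj₂ ji∈) = contradiction (s≤s i<j) (ℕ.<-asym (edge-ordered (tower r) ji∈))

segsOf-edge : ∀ ks {e} → e ∈ edgesOf ks → e ∈ segsOf ks
segsOf-edge (k ∷ ks) {u , v} uv∈ with edge-view k ks uv∈
... | inj₁ here∈ = ∈-++⁺ˡ (∈-++⁺ʳ (map (λ x → (x , x)) (own k)) here∈)
... | inj₂ (_ , _ , u′v′∈ , refl , refl) = ∈-++⁺ʳ (pieceSegs k) (∈-map⁺ shift (segsOf-edge ks u′v′∈))

segsOf-point : ∀ k ks {x} → x ∈ own k → (x , x) ∈ segsOf (k ∷ ks)
segsOf-point k ks x∈ = ∈-++⁺ˡ (∈-++⁺ˡ (∈-map⁺ (λ x → (x , x)) x∈))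

segsOf-above : ∀ k ks {e} → e ∈ segsOf ks → shift e ∈ segsOf (k ∷ ks)
segsOf-above k ks e∈ = ∈-++⁺ʳ (pieceSegs k) (∈-map⁺ shift e∈)

storeys-point : ∀ r i → i < 23 + r ℕ.* 24 → (4 + i , 4 + i) ∈ segsOf (storeys r)
storeys-point zero    i i<23 = segsOf-point top [] (∈-applyUpTo⁺ (4 ℕ.+_) i<23)
storeys-point (suc r) i i<   = Sum.[ low , high ]′ (ℕ.<-≤-connex i 24)
  where
  low : i < 24 → (4 + i , 4 + i) ∈ segsOf (ring ∷ storeys r)
  low i<24 = segsOf-point ring (storeys r) (∈-applyUpTo⁺ (4 ℕ.+_) i<24)

  above : ∀ j → 24 + j < 47 + r ℕ.* 24 → (28 + j , 28 + j) ∈ segsOf (ring ∷ storeys r)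
  above j j< = segsOf-above ring (storeys r) (storeys-point r j (ℕ.+-cancelˡ-< 24 j (23 + r ℕ.* 24) j<))

  high : 24 ≤ i → (4 + i , 4 + i) ∈ segsOf (ring ∷ storeys r)
  high 24≤i = subst (λ i → (4 + i , 4 + i) ∈ segsOf (ring ∷ storeys r)) (ℕ.m+[n∸m]≡n 24≤i)
    (above (i ∸ 24) (subst (_< 47 + r ℕ.* 24) (sym (ℕ.m+[n∸m]≡n 24≤i)) i<))

tower-point : ∀ r i → i < size r → (suc i , suc i) ∈ segsOf (tower r)
tower-point r i i< = Sum.[ low , high ]′ (ℕ.<-≤-connex i 27)
  where
  low : i < 27 → (suc i , suc i) ∈ segsOf (tower r)
  low i<27 = segsOf-point bottom (storeys r) (∈-applyUpTo⁺ (1 ℕ.+_) i<27)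

  above : ∀ j → 27 + j < size r → (28 + j , 28 + j) ∈ segsOf (tower r)
  above j j< = segsOf-above bottom (storeys r) (storeys-point r j (ℕ.+-cancelˡ-< 27 j (23 + r ℕ.* 24) j<))

  high : 27 ≤ i → (suc i , suc i) ∈ segsOf (tower r)
  high 27≤i = subst (λ i → (suc i , suc i) ∈ segsOf (tower r)) (ℕ.m+[n∸m]≡n 27≤i)
    (above (i ∸ 27) (subst (_< size r) (sym (ℕ.m+[n∸m]≡n 27≤i)) i<))

drawing : ∀ r → Planar (graph r)
drawing r = StraightLine.planar (graph r) (towerPos r) (tower-separated r)
  (λ i → tower-point r (toℕ i) (Fin.toℕ<n i)) (λ ij → segsOf-edge (tower r) (edge∈ r ij))

-- Forbidden subgraphs

K₄-free : ∀ r → ¬ (K₄ ⊑ graph r)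
K₄-free r (f , _ , adj) = clique-free (tower r) (tower-noClique r) {code ∘ f} (λ {i} {j} → adj {i} {j})

C₆-free : ∀ r → ¬ (C₆ ⊑ graph r)
C₆-free r (f , inj , adj) = hexagon-free (tower r) (tower-noHexagon r) {code ∘ f}
  ( inj ∘ code-injective
  , λ { 0F → adj {0F} {1F} (inj₁ refl) ; 1F → adj {1F} {2F} (inj₁ refl) ; 2F → adj {2F} {3F} (inj₁ refl)
      ; 3F → adj {3F} {4F} (inj₁ refl) ; 4F → adj {4F} {5F} (inj₁ refl) ; 5F → adj {5F} {0F} (inj₁ refl) } )

-- Counting edges

pieceEdges-unique : ∀ k → Unique (pieceEdges k)
pieceEdges-unique = λ { bottom → toWitness {a? = check? bottom} tt
                      ; ring   → toWitness {a? = check? ring} tt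
                      ; top    → toWitness {a? = check? top} tt }
  where
  check? : ∀ k → Dec (Unique (pieceEdges k))
  check? k = AllPairs.allPairs? (λ e e′ → ¬? (Product.≡-dec ℕ._≟_ ℕ._≟_ e e′)) (pieceEdges k)

edges-unique : ∀ ks → Unique (edgesOf ks)
edges-unique []       = []
edges-unique (k ∷ ks) = Unique.++⁺ (pieceEdges-unique k) (Unique.map⁺ shift-injective (edges-unique ks)) disjoint
  where
  shift-injective : ∀ {e e′} → shift e ≡ shift e′ → e ≡ e′
  shift-injective {u , v} {u′ , v′} refl = refl

  disjoint : ∀ {e} → ¬ (e ∈ pieceEdges k × e ∈ map shift (edgesOf ks))
  disjoint (here∈ , above∈) with (u , v) , _ , refl ← ∈-map⁻ shift above∈ =
    ℕ.<⇒≱ (proj₁ (All.lookup (pieceEdges-ordered k) here∈)) (ℕ.m≤m+n 24 u)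

storeys-bound : ∀ r {u v} → (u , v) ∈ edgesOf (storeys r) → v ≤ 26 + r ℕ.* 24
storeys-bound zero uv∈ with edge-view top [] uv∈
... | inj₁ here∈ = All.lookup (toWitness {a? = All.all? (λ e → proj₂ e ℕ.≤? 26) (pieceEdges top)} tt) here∈
storeys-bound (suc r) uv∈ with edge-view ring (storeys r) uv∈
... | inj₁ here∈ = ℕ.≤-trans
  (All.lookup (toWitness {a? = All.all? (λ e → proj₂ e ℕ.≤? 50) (pieceEdges ring)} tt) here∈)
  (ℕ.m≤m+n 50 (r ℕ.* 24))
... | inj₂ (_ , _ , u′v′∈ , refl , refl) = ℕ.+-monoʳ-≤ 24 (storeys-bound r u′v′∈)

tower-bound : ∀ r {u v} → (u , v) ∈ edgesOf (tower r) → 1 ≤ u × v ≤ size r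
tower-bound r uv∈ with edge-view bottom (storeys r) uv∈
... | inj₁ here∈ =
  let check?     = All.all? (λ e → (1 ℕ.≤? proj₁ e) ×-dec (proj₂ e ℕ.≤? 50)) (pieceEdges bottom)
      1≤u , v≤50 = All.lookup (toWitness {a? = check?} tt) here∈
  in 1≤u , ℕ.≤-trans v≤50 (ℕ.m≤m+n 50 (r ℕ.* 24))
... | inj₂ (_ , _ , u′v′∈ , refl , refl) = s≤s z≤n , ℕ.+-monoʳ-≤ 24 (storeys-bound r u′v′∈)

code-onto : ∀ {n c} → 1 ≤ c → c ≤ n → ∃[ i ] c ≡ code {n} i
code-onto {c = suc c} (s≤s _) c<n = fromℕ< c<n , cong suc (sym (Fin.toℕ-fromℕ< c<n))

-- Two duplicate-free lists with the same members are permutations of each other, hence equally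
-- long.
e≡length : ∀ {n} (G : SimpleGraph n) (E : List Pair) → let open SimpleGraph G using (IsEdge) in Unique E →
           (∀ {i j} → IsEdge i j → (code i , code j) ∈ E) →
           (∀ {c} → c ∈ E → Σ (Fin n × Fin n) λ (i , j) → c ≡ codes (i , j) × IsEdge i j) →
           e G ≡ length E
e≡length {n} G E E! sound complete =
  trans (sym (length-map codes edges)) (↭-length (∼bag⇒↭ (unique∧set⇒bag
    (Unique.map⁺ codes-injective (Unique.filter⁺ edge?
      (Unique.cartesianProduct⁺ (Unique.allFin⁺ n) (Unique.allFin⁺ n))))
    E! (mk⇔ to from))))
  where
  open SimpleGraph G using (edges; isEdge?; IsEdge)

  edge? : ∀ (ij : Fin n × Fin n) → Dec (IsEdge (proj₁ ij) (proj₂ ij))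
  edge? (i , j) = isEdge? i j

  to : ∀ {c} → c ∈ map codes edges → c ∈ E
  to c∈ with _ , ij∈ , refl ← ∈-map⁻ codes c∈ =
    sound (proj₂ (∈-filter⁻ edge? {xs = cartesianProduct (allFin n) (allFin n)} ij∈))

  from : ∀ {c} → c ∈ E → c ∈ map codes edges
  from c∈ with (i , j) , refl , ij ← complete c∈ =
    ∈-map⁺ codes (∈-filter⁺ edge? (∈-cartesianProduct⁺ (∈-allFin i) (∈-allFin j)) ij)

tower-edge : ∀ r {c} → c ∈ edgesOf (tower r) →
             Σ (Fin (size r) × Fin (size r)) λ (i , j) → c ≡ codes (i , j) × SimpleGraph.IsEdge (graph r) i j
tower-edge r {u , v} uv∈ = (proj₁ onto-u , proj₁ onto-v) , cong₂ _,_ (proj₂ onto-u) (proj₂ onto-v) ,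
  ℕ.s≤s⁻¹ (subst₂ _<_ (proj₂ onto-u) (proj₂ onto-v) u<v) ,
  inj₁ (subst₂ (λ u v → (u , v) ∈ edgesOf (tower r)) (proj₂ onto-u) (proj₂ onto-v) uv∈)
  where
  u<v : u < v
  u<v = edge-ordered (tower r) uv∈

  1≤u : 1 ≤ u
  1≤u = proj₁ (tower-bound r uv∈)

  v≤n : v ≤ size r
  v≤n = proj₂ (tower-bound r uv∈)

  onto-u : ∃[ i ] u ≡ code {size r} i
  onto-u = code-onto 1≤u (ℕ.≤-trans (ℕ.<⇒≤ u<v) v≤n)

  onto-v : ∃[ j ] v ≡ code {size r} j
  onto-v = code-onto (ℕ.≤-trans 1≤u (ℕ.<⇒≤ u<v)) v≤n

e-graph : ∀ r → e (graph r) ≡ length (edgesOf (tower r))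
e-graph r = e≡length (graph r) (edgesOf (tower r)) (edges-unique (tower r)) (edge∈ r) (tower-edge r)

edgesOf-length : ∀ ks → length (edgesOf ks) ≡ length ks ℕ.* 56
edgesOf-length []       = refl
edgesOf-length (k ∷ ks) = trans (length-++ (pieceEdges k))
  (cong₂ _+_ (fifty-six k) (trans (length-map shift (edgesOf ks)) (edgesOf-length ks)))
  where
  -- Seven wheels with 8 edges each.
  fifty-six : ∀ k → length (pieceEdges k) ≡ 56
  fifty-six bottom = refl
  fifty-six ring   = refl
  fifty-six top    = refl

storeys-length : ∀ r → length (storeys r) ≡ suc r
storeys-length zero    = refl
storeys-length (suc r) = cong suc (storeys-length r)

e-value : ∀ r → e (graph r) ≡ 7 ℕ.* (16 + r ℕ.* 8)
e-value r = begin
  e (graph r)                 ≡⟨ e-graph r ⟩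
  length (edgesOf (tower r))  ≡⟨ edgesOf-length (tower r) ⟩
  length (tower r) ℕ.* 56     ≡⟨ cong (ℕ._* 56) (cong suc (storeys-length r)) ⟩
  suc (suc r) ℕ.* 56          ≡⟨ lemma r ⟩
  7 ℕ.* (16 + r ℕ.* 8)        ∎
  where
  open ≡-Reasoning
  lemma : ∀ r → suc (suc r) ℕ.* 56 ≡ 7 ℕ.* (16 + r ℕ.* 8)
  lemma = solve-∀

tight : ∀ r → (+ e (graph r)) / 1 ≡ ((+ 7) / 3) ℚ.* ((+ size r) / 1 ℚ.- (+ 2) / 1)
tight r = sym (begin
  (+ 7) / 3 ℚ.* (ι (+ size r) ℚ.+ ι (ℤ.- + 2))  ≡⟨ cong ((+ 7) / 3 ℚ.*_) (ι-+ (+ size r) (ℤ.- + 2)) ⟨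
  (+ 7) / 3 ℚ.* ι (+ (48 + r ℕ.* 24))           ≡⟨ cong (λ x → (+ 7) / 3 ℚ.* ι (+ x)) (lemma r) ⟩
  (+ 7) / 3 ℚ.* ι (+ (3 ℕ.* m))                 ≡⟨ cong (λ x → (+ 7) / 3 ℚ.* ι x) (ℤ.pos-* 3 m) ⟩
  (+ 7) / 3 ℚ.* ι (+ 3 ℤ.* + m)                 ≡⟨ cong ((+ 7) / 3 ℚ.*_) (ι-* (+ 3) (+ m)) ⟩
  (+ 7) / 3 ℚ.* (ι (+ 3) ℚ.* ι (+ m))           ≡⟨ ℚ.*-assoc ((+ 7) / 3) (ι (+ 3)) (ι (+ m)) ⟨
  -- The product of the closed rationals 7/3 and 3 computes to 7.
  ι (+ 7) ℚ.* ι (+ m)                           ≡⟨ ι-* (+ 7) (+ m) ⟨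
  ι (+ 7 ℤ.* + m)                               ≡⟨ cong ι (ℤ.pos-* 7 m) ⟨
  ι (+ (7 ℕ.* m))                               ≡⟨ cong (λ x → ι (+ x)) (e-value r) ⟨
  ι (+ e (graph r))                             ∎)
  where
  open ≡-Reasoning
  -- This is (n - 2)/3 for n = 50 + 24r.
  m : ℕ
  m = 16 + r ℕ.* 8
  lemma : ∀ r → 48 + r ℕ.* 24 ≡ 3 ℕ.* (16 + r ℕ.* 8)
  lemma = solve-∀

theorem4 : ∀ (n : ℕ) → 0 < n → n % 288 ≡ 50 →
    Σ (SimpleGraph n) λ G →
    Planar G × ¬ (K₄ ⊑ G) × ¬ (C₆ ⊑ G) ×
    (+ e G) / 1 ≡ ((+ 7) / 3) * ((+ n) / 1 - (+ 2) / 1)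
theorem4 n _ n%288≡50 = subst
  (λ n → Σ (SimpleGraph n) λ G → Planar G × ¬ (K₄ ⊑ G) × ¬ (C₆ ⊑ G) ×
         (+ e G) / 1 ≡ ((+ 7) / 3) * ((+ n) / 1 - (+ 2) / 1))
  size≡n (graph r , drawing r , K₄-free r , C₆-free r , tight r)
  where
  r : ℕ
  r = n ℕ./ 288 ℕ.* 12

  -- Here 12 · 24 = 288 turns the rings into the quotient part of the division of `n` by 288, and 50
  -- is the remainder.
  size≡n : size r ≡ n
  size≡n = trans (cong₂ _+_ (sym n%288≡50) (ℕ.*-assoc (n ℕ./ 288) 12 24)) (sym (ℕ.m≡m%n+[m/n]*n n 288))
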